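{- Each of the following hereditary classes of graphs interprets grids: (1) the class of bichain graphs; (2) the class of split permutation graphs; (3) the class of bipartite permutation graphs; (4) the class of unit interval graphs.
   Context: Graphs are finite, simple, undirected. For a vertex $v$, $N(v)$ is its neighbourhood. A sequence $v_1,\dots,v_k$ of vertices is a chain if $N(v_i)\subseteq N(v_j)$ whenever $i\le j$. A bipartite graph with parts $A,B$ is a $k$-chain graph if each of $A$ and $B$ can be partitioned into at most $k$ chains; a bichain graph is a $2$-chain graph. A split graph is one whose vertex set can be partitioned into a clique and an independent set; split permutation graphs are graphs that are both split graphs and permutation graphs; bipartite permutation graphs are graphs that are both bipartite and permutation graphs; unit interval graphs are intersection graphs of families of intervals of unit length on the real line. An $\mathrm{MSO}$ interpretation with parameters $\bar Z$ (set variables) is a pair $\Psi(\bar Z)=(\psi(x,\bar Z),\psi_E(x,y,\bar Z))$ of $\mathrm{MSO}$ formulas over graphs; for a graph $G$ and subsets $\bar A$ of $V(G)$, $\Psi((G,\bar A))$ has vertex set $\{a:G\models\psi(a,\bar A)\}$ and edge relation $\{(a,b):G\models\psi_E(a,b,\bar A)\}$, and $\Psi(\mathcal{C})=\{\Psi((G,\bar A)): G\in\mathcal{C}, \bar A \text{ arbitrary}\}$. A class $\mathcal{C}$ interprets grids if there is an $\mathrm{MSO}$ interpretation $\Phi$ such that $\Phi(\mathcal{C})$ contains isomorphic copies of arbitrarily large square grids (the $n\times n$ grid has vertices $(i,j)$, $1\le i,j\le n$, with $(i,j)$ adjacent to $(i,j+1)$ and $(i+1,j)$ when these exist). -}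

module Defs where

open import Data.Nat as ℕ using (ℕ; zero; suc)
open import Data.Fin using (Fin; zero; suc; toℕ; _<_)
open import Data.Bool using (Bool; true; false)
open import Data.Product using (Σ; _×_; _,_)
open import Data.Sum using (_⊎_)
open import Data.Empty using (⊥)
open import Relation.Nullary using (¬_)
open import Relation.Binary.PropositionalEquality using (_≡_; _≢_)
open import Function.Bundles using (_⇔_)
open import Function.Definitions using (Injective)
open import Data.Rational as ℚ using (ℚ; 1ℚ; ∣_∣; _-_)

record Graph : Set where
  field
    size    : ℕ
    adj     : Fin size → Fin size → Bool
    adj-sym : ∀ u v → adj u v ≡ adj v u
    adj-irr : ∀ v → adj v v ≡ false

open Graph public

V : Graph → Set
V G = Fin (size G)

Edge : (G : Graph) → V G → V G → Set
Edge G u v = adj G u v ≡ true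

-- MSO logic over graphs.  Formula i j has i free element variables and
-- j free set variables (de Bruijn indices).

data Formula (i j : ℕ) : Set where
  edge   : Fin i → Fin i → Formula i j
  equal  : Fin i → Fin i → Formula i j
  member : Fin i → Fin j → Formula i j
  neg    : Formula i j → Formula i j
  and    : Formula i j → Formula i j → Formula i j
  or     : Formula i j → Formula i j → Formula i j
  ex     : Formula (suc i) j → Formula i j
  exSet  : Formula i (suc j) → Formula i j

extend : ∀ {n} {A : Set} → A → (Fin n → A) → Fin (suc n) → A
extend a ρ zero    = a
extend a ρ (suc x) = ρ x

Sat : ∀ {i j} (G : Graph) → (Fin i → V G) → (Fin j → V G → Bool) → Formula i j → Set
Sat G ρ σ (edge x y)   = Edge G (ρ x) (ρ y)
Sat G ρ σ (equal x y)  = ρ x ≡ ρ y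
Sat G ρ σ (member x X) = σ X (ρ x) ≡ true
Sat G ρ σ (neg φ)      = ¬ Sat G ρ σ φ
Sat G ρ σ (and φ ψ)    = Sat G ρ σ φ × Sat G ρ σ ψ
Sat G ρ σ (or φ ψ)     = Sat G ρ σ φ ⊎ Sat G ρ σ ψ
Sat G ρ σ (ex φ)       = Σ (V G) λ a → Sat G (extend a ρ) σ φ
Sat G ρ σ (exSet φ)    = Σ (V G → Bool) λ S → Sat G ρ (extend S σ) φ

record Interpretation (k : ℕ) : Set where
  field
    ψ  : Formula 1 k
    ψE : Formula 2 k

open Interpretation public

env1 : ∀ {A : Set} → A → Fin 1 → A
env1 a _ = a

env2 : ∀ {A : Set} → A → A → Fin 2 → A
env2 a b = extend a (env1 b)

GridAdj : ∀ {n} → Fin n × Fin n → Fin n × Fin n → Set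
GridAdj (i , j) (i' , j') =
    (i ≡ i' × (toℕ j' ≡ suc (toℕ j) ⊎ toℕ j ≡ suc (toℕ j')))
  ⊎ (j ≡ j' × (toℕ i' ≡ suc (toℕ i) ⊎ toℕ i ≡ suc (toℕ i')))

GridCopy : ∀ {k} → Interpretation k → (G : Graph) → (Fin k → V G → Bool) → ℕ → Set
GridCopy Ψ G Ā n =
  Σ (Fin n × Fin n → V G) λ f →
      Injective _≡_ _≡_ f
    × (∀ u → Sat G (env1 (f u)) Ā (ψ Ψ))
    × (∀ a → Sat G (env1 a) Ā (ψ Ψ) → Σ (Fin n × Fin n) λ u → f u ≡ a)
    × (∀ u v → GridAdj u v ⇔ Sat G (env2 (f u) (f v)) Ā (ψE Ψ))

InterpretsGrids : (Graph → Set) → Set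
InterpretsGrids 𝒞 =
  Σ ℕ λ k → Σ (Interpretation k) λ Ψ →
    ∀ m → Σ ℕ λ n → m ℕ.≤ n ×
      Σ Graph λ G → 𝒞 G × Σ (Fin k → V G → Bool) λ Ā → GridCopy Ψ G Ā n

IsBipartition : (G : Graph) → (V G → Bool) → Set
IsBipartition G side = ∀ u v → Edge G u v → side u ≢ side v

IsChain : (G : Graph) → (V G → Set) → Set
IsChain G S =
  Σ ℕ λ m → Σ (Fin m → V G) λ f →
      Injective _≡_ _≡_ f
    × (∀ i → S (f i))
    × (∀ v → S v → Σ (Fin m) λ i → f i ≡ v)
    × (∀ i j → toℕ i ℕ.≤ toℕ j → Subset-N (f i) (f j))
  where
  Subset-N : V G → V G → Set
  Subset-N v w = ∀ x → Edge G v x → Edge G w x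

ChainPartition : (G : Graph) → ℕ → (V G → Set) → Set
ChainPartition G k P =
  Σ (V G → Fin k) λ c → ∀ t → IsChain G (λ v → P v × c v ≡ t)

KChain : ℕ → Graph → Set
KChain k G =
  Σ (V G → Bool) λ side →
      IsBipartition G side
    × ChainPartition G k (λ v → side v ≡ false)
    × ChainPartition G k (λ v → side v ≡ true)

Bichain : Graph → Set
Bichain = KChain 2

Bipartite : Graph → Set
Bipartite G = Σ (V G → Bool) λ side → IsBipartition G side

Split : Graph → Set
Split G =
  Σ (V G → Bool) λ inK →
      (∀ u v → u ≢ v → inK u ≡ true → inK v ≡ true → Edge G u v)
    × (∀ u v → inK u ≡ false → inK v ≡ false → ¬ Edge G u v)

-- permutation graph: two linear orders p, q of the vertices (positions on
-- two parallel lines); u ~ v iff the orders disagree on u, v.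
Permutation : Graph → Set
Permutation G =
  Σ (V G → Fin (size G)) λ p → Σ (V G → Fin (size G)) λ q →
      Injective _≡_ _≡_ p × Injective _≡_ _≡_ q
    × (∀ u v → Edge G u v ⇔ ((p u < p v × q v < q u) ⊎ (p v < p u × q u < q v)))

SplitPermutation : Graph → Set
SplitPermutation G = Split G × Permutation G

BipartitePermutation : Graph → Set
BipartitePermutation G = Bipartite G × Permutation G

-- unit interval graph: vertex v ↦ closed interval [x v, x v + 1]
-- (endpoints rational)
UnitInterval : Graph → Set
UnitInterval G =
  Σ (V G → ℚ) λ x →
    ∀ u v → u ≢ v → (Edge G u v ⇔ (∣ x u - x v ∣ ℚ.≤ 1ℚ))

{-# OPTIONS --safe #-}

-- All four classes contain, for every n, a graph with vertices carrying the
-- positions n * i + j of the cells (i , j) with i ≤ n and j < n, in which MSO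
-- defines "the positions differ by at most n".  With the residue of i modulo 3
-- as a parameter this yields the relation "cell (i' , j') has i' = i + 1 and
-- j' ≤ j" between consecutive columns.  Comparing such neighbourhoods orders
-- every column, and the two kinds of grid edges are covers in these orders.
-- For unit intervals of length n starting at the positions, closeness is
-- adjacency itself; for bipartite permutation graphs it is adjacency up to
-- the parity of i.  In a (split or bipartite) graph of four chains, closeness
-- is read off by going once around the cycle A₀ B₀ A₁ B₁: three of the
-- half graphs compare positions, and the fourth shifts them by n.

module Submission where

open import Defs
open import Data.Product using (Σ; ∃; ∃₂; _×_; _,_; proj₁; proj₂; uncurry; swap)
open import Algebra.Properties.Group using (//-rightDividesˡ; //-rightDividesʳ; ⁻¹-anti-homo-//)
open import Data.Bool using (Bool; true; false; not)
open import Data.Empty using (⊥-elim)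
open import Data.Fin as Fin using (Fin; zero; suc; toℕ; fromℕ<; inject₁; combine; opposite)
open import Data.Fin.Patterns using (0F; 1F; 2F)
import Data.Fin.Properties as Finₚ
open import Data.Fin.Subset using (Subset; _∈_; ∣_∣)
open import Data.Fin.Subset.Properties using (∣⊤∣≡n; p⊂q⇒∣p∣<∣q∣; ∈⊤)
open import Data.Integer as ℤ using (ℤ; -[1+_]; +<+; -<-; -<+) renaming (+_ to pos⁺)
import Data.Integer.Properties as ℤₚ
open import Data.Nat using (ℕ; zero; suc; _+_; _*_; _≤_; _<_; s≤s; s≤s⁻¹; _<?_)
open import Data.Nat.Properties
open import Data.Product.Function.NonDependent.Propositional using (_×-⇔_; _×-↔_)
open import Data.Product.Properties using (≡-dec)
open import Data.Rational as ℚ using (ℚ; 0ℚ; 1ℚ)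
import Data.Rational.Properties as ℚₚ
open import Data.Rational.Unnormalised as ℚᵘ using (ℚᵘ; mkℚᵘ)
import Data.Rational.Unnormalised.Properties as ℚᵘₚ
open import Data.Sum as Sum using (_⊎_; inj₁; inj₂; [_,_])
open import Data.Sum.Function.Propositional using (_⊎-⇔_)
open import Data.Vec using (tabulate)
open import Data.Vec.Properties using (lookup∘tabulate; lookup⇒[]=; []=⇒lookup)
open import Function using (_∘_; id)
open import Function.Bundles using (_⇔_; mk⇔; Equivalence; _↔_; Inverse)
open import Function.Definitions using (Injective)
open import Function.Properties.Equivalence using () renaming (sym to ⇔-sym; trans to ⇔-trans)
open import Function.Properties.Inverse using (↔-refl; ↔-trans)
open import Relation.Binary using (IsStrictTotalOrder; tri<; tri≈; tri>)
open import Relation.Binary.PropositionalEquality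
  using (_≡_; _≢_; refl; sym; trans; cong; cong₂; subst; subst₂; module ≡-Reasoning)
open import Relation.Nullary using (¬_; Dec; yes; no; does; contradiction)
open import Relation.Nullary.Decidable using (_×-dec_; _⊎-dec_; ¬?; map′; dec-false; does-⇔)

open Equivalence using (to; from)

-- Preliminaries: decisions as booleans, residues modulo 3.

does-true : ∀ {A : Set} (A? : Dec A) → does A? ≡ true ⇔ A
does-true (yes a) = mk⇔ (λ _ → a) (λ _ → refl)
does-true (no ¬a) = mk⇔ (λ ()) (λ a → contradiction a ¬a)

rotate : Fin 3 → Fin 3
rotate zero             = suc zero
rotate (suc zero)       = suc (suc zero)
rotate (suc (suc zero)) = zero

mod3 : ℕ → Fin 3
mod3 zero    = zero
mod3 (suc n) = rotate (mod3 n)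

rotate-≢ : ∀ c → c ≢ rotate c
rotate-≢ zero             ()
rotate-≢ (suc zero)       ()
rotate-≢ (suc (suc zero)) ()

rotate²-≢ : ∀ c → c ≢ rotate (rotate c)
rotate²-≢ zero             ()
rotate²-≢ (suc zero)       ()
rotate²-≢ (suc (suc zero)) ()

-- The bounds leave only `i - 1`, `i` and `i + 1` for `i'`, and these have three different residues.
mod3-successor : ∀ i i' → i' ≤ suc i → i ≤ suc i' → mod3 i' ≡ rotate (mod3 i) → i' ≡ suc i
mod3-successor i i' i'≤1+i i≤1+i' eq with m≤n⇒m<n∨m≡n i'≤1+i | m≤n⇒m<n∨m≡n i≤1+i'
... | inj₂ i'≡1+i | _            = i'≡1+i
... | _           | inj₂ refl    = contradiction eq (rotate²-≢ (mod3 i'))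
... | inj₁ i'<1+i | inj₁ i<1+i'  with refl ← ≤-antisym (s≤s⁻¹ i'<1+i) (s≤s⁻¹ i<1+i') =
  contradiction eq (rotate-≢ (mod3 i))

-- Cells, positions and nearness.

Cell : ℕ → Set
Cell n = Fin (suc n) × Fin n

col row pos : ∀ {n} → Cell n → ℕ
col (i , _) = toℕ i
row (_ , j) = toℕ j
pos {n} u = n * col u + row u

Near : ∀ {n} → Cell n → Cell n → Set
Near {n} u v = pos v ≤ pos u + n × pos u ≤ pos v + n

row<n : ∀ {n} (u : Cell n) → row u < n
row<n (_ , j) = Finₚ.toℕ<n j

-- A cell two or more columns ahead has position at least `n * col u + 2 * n`, which exceeds
-- `pos u + n` because `row u < n`.
pos-≤⇒col-≤ : ∀ {n} (u v : Cell n) → pos v ≤ pos u + n → col v ≤ suc (col u)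
pos-≤⇒col-≤ {n} u v h = ≮⇒≥ λ far → <-irrefl refl (begin-strict
  n * col u + row u + n   <⟨ +-monoˡ-< n (+-monoʳ-< (n * col u) (row<n u)) ⟩
  n * col u + n + n       ≡⟨ cong (_+ n) (+-comm (n * col u) n) ⟩
  n + n * col u + n       ≡⟨ +-comm _ n ⟩
  n + (n + n * col u)     ≡⟨ cong (n +_) (sym (*-suc n (col u))) ⟩
  n + n * suc (col u)     ≡⟨ sym (*-suc n (suc (col u))) ⟩
  n * suc (suc (col u))   ≤⟨ *-monoʳ-≤ n far ⟩
  n * col v               ≤⟨ m≤m+n _ _ ⟩
  n * col v + row v       ≤⟨ h ⟩
  n * col u + row u + n   ∎)
  where open ≤-Reasoning

pos-next : ∀ {n} (u v : Cell n) → col v ≡ suc (col u) → pos v ≡ n * col u + row v + n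
pos-next {n} u v eq = begin
  n * col v + row v           ≡⟨ cong (λ i → n * i + row v) eq ⟩
  n * suc (col u) + row v     ≡⟨ cong (_+ row v) (*-suc n (col u)) ⟩
  n + n * col u + row v       ≡⟨ +-assoc n _ _ ⟩
  n + (n * col u + row v)     ≡⟨ +-comm n _ ⟩
  n * col u + row v + n       ∎
  where open ≡-Reasoning

NextClass : ∀ {n} → Cell n → Cell n → Set
NextClass u v = mod3 (col v) ≡ rotate (mod3 (col u))

NextBelow : ∀ {n} → Cell n → Cell n → Set
NextBelow u v = col v ≡ suc (col u) × row v ≤ row u

-- Nearness bounds the column difference by one and the residue then fixes it. Moving one column
-- ahead adds exactly `n` to the position, so the bound on `pos v` cancels to one on rows.
near⇒nextBelow : ∀ {n} (u v : Cell n) → NextClass u v → Near u v → NextBelow u v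
near⇒nextBelow {n} u v label (h , h') = next ,
  +-cancelˡ-≤ (n * col u) _ _ (+-cancelʳ-≤ n _ _ (subst (_≤ pos u + n) (pos-next u v next) h))
  where next = mod3-successor (col u) (col v) (pos-≤⇒col-≤ u v h) (pos-≤⇒col-≤ v u h') label

-- The bound on `pos v` is the row inequality shifted by `n`; the bound on `pos u` holds for every
-- cell of the next column, as `row u < n`.
nextBelow⇒near : ∀ {n} (u v : Cell n) → NextBelow u v → Near u v
nextBelow⇒near {n} u v (next , le) rewrite pos-next u v next =
  +-monoˡ-≤ n (+-monoʳ-≤ (n * col u) le) ,
  (begin
    n * col u + row u        ≤⟨ +-monoʳ-≤ _ (<⇒≤ (row<n u)) ⟩
    n * col u + n            ≤⟨ +-monoˡ-≤ n (m≤m+n _ (row v)) ⟩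
    n * col u + row v + n    ≤⟨ m≤m+n _ n ⟩
    n * col u + row v + n + n ∎)
  where open ≤-Reasoning

Below RowSuccessor ColumnSuccessor : ∀ {n} → Cell n → Cell n → Set
Below u v = col u ≡ col v × row u < row v
RowSuccessor u v = col u ≡ col v × row v ≡ suc (row u)
ColumnSuccessor u v = row u ≡ row v × col v ≡ suc (col u)

-- If `v` were further up, the cell `w` directly above `u` in the same column would lie strictly
-- between.
below-cover : ∀ {n} (u v : Cell n) → Below u v → (∀ w → Below u w → ¬ Below w v) → RowSuccessor u v
below-cover {n} u v (same , u<v) none with m≤n⇒m<n∨m≡n u<v
... | inj₂ eq    = same , sym eq
... | inj₁ 1+u<v = ⊥-elim (none w (refl , ≤-reflexive (sym roww))
                                  (same , subst (_< row v) (sym roww) 1+u<v))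
  where
  w : Cell n
  w = proj₁ u , fromℕ< (<-trans 1+u<v (row<n v))
  roww : row w ≡ suc (row u)
  roww = Finₚ.toℕ-fromℕ< _

below-empty : ∀ {n} (u v w : Cell n) → RowSuccessor u v → Below u w → ¬ Below w v
below-empty u v w (_ , eq) (_ , u<w) (_ , w<v) = <⇒≱ u<w (s≤s⁻¹ (subst (row w <_) eq w<v))

-- The cells of the next column related to `u` are those up to row `row u`, so the topmost one lies
-- in the row of `u`; that cell refutes maximality of any lower `v`.
nextBelow-max : ∀ {n} (u v : Cell n) → NextBelow u v → (∀ w → NextBelow u w → ¬ Below v w) →
                ColumnSuccessor u v
nextBelow-max u v (next , v≤u) none with m≤n⇒m<n∨m≡n v≤u
... | inj₂ eq  = sym eq , next
... | inj₁ v<u = ⊥-elim (none (proj₁ v , proj₂ u) (next , ≤-refl) (refl , v<u))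

-- The formulas of the interpretation.

BinaryFormula : ℕ → Set
BinaryFormula k = ∀ {i} → Fin i → Fin i → Formula i k

pattern columnClass0 = zero
pattern columnClass1 = suc zero
pattern columnClass2 = suc (suc zero)
pattern gridDomain   = suc (suc (suc zero))
pattern extra X      = suc (suc (suc (suc X)))

columnClass : ∀ {k} → Fin 3 → Fin (4 + k)
columnClass zero             = columnClass0
columnClass (suc zero)       = columnClass1
columnClass (suc (suc zero)) = columnClass2

nextClass : ∀ {k} → BinaryFormula (4 + k)
nextClass {k} {i} x y = or (step zero) (or (step (suc zero)) (step (suc (suc zero))))
  where
  step : Fin 3 → Formula i (4 + k)
  step c = and (member x (columnClass c)) (member y (columnClass (rotate c)))

module _ {k} (near : BinaryFormula (4 + k)) where

  -- A column is ordered by inclusion of the neighbourhoods in the next column; the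
  -- second conjunct of below, a common neighbour there, says that x and y share a column.
  nextBelow below rowSuccessor columnSuccessor gridEdge : BinaryFormula (4 + k)
  nextBelow x y = and (nextClass x y) (near x y)
  below x y =
    and (ex (and (nextBelow (suc y) zero) (neg (nextBelow (suc x) zero))))
        (ex (and (nextBelow (suc x) zero) (nextBelow (suc y) zero)))
  rowSuccessor x y =
    and (below x y) (neg (ex (and (below (suc x) zero) (below zero (suc y)))))
  columnSuccessor x y =
    and (nextBelow x y) (neg (ex (and (nextBelow (suc x) zero) (below (suc y) zero))))
  gridEdge x y =
    or (or (rowSuccessor x y) (rowSuccessor y x))
       (or (columnSuccessor x y) (columnSuccessor y x))

  -- The last column only witnesses the order of the others, so it is left out.
  gridInterpretation : Interpretation (4 + k)
  gridInterpretation = record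
    { ψ  = member zero gridDomain
    ; ψE = gridEdge zero (suc zero)
    }

-- Correctness of the interpretation.

module _ {n} (G : Graph) (emb : Cell n → V G) where

  InImage : (Cell n → Set) → V G → Set
  InImage P a = ∃ λ u → a ≡ emb u × P u

  inImage? : ∀ {P} → (∀ u → Dec (P u)) → ∀ a → Dec (InImage P a)
  inImage? P? a = map′ (λ (i , j , h) → (i , j) , h) (λ ((i , j) , h) → i , j , h)
    (Finₚ.any? λ i → Finₚ.any? λ j → (a Finₚ.≟ emb (i , j)) ×-dec P? (i , j))

  inColumnClass? : ∀ c (u : Cell n) → Dec (mod3 (col u) ≡ c)
  inColumnClass? c u = mod3 (col u) Finₚ.≟ c

  inGrid? : ∀ (u : Cell n) → Dec (col u < n)
  inGrid? u = col u <? n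

  parameters : ∀ {k} → (Fin k → V G → Bool) → Fin (4 + k) → V G → Bool
  parameters σ columnClass0 a = does (inImage? (inColumnClass? zero) a)
  parameters σ columnClass1 a = does (inImage? (inColumnClass? (suc zero)) a)
  parameters σ columnClass2 a = does (inImage? (inColumnClass? (suc (suc zero))) a)
  parameters σ gridDomain   a = does (inImage? inGrid? a)
  parameters σ (extra X)    a = σ X a

  parameters-columnClass : ∀ {k} (σ : Fin k → V G → Bool) c a →
    parameters σ (columnClass c) a ≡ true ⇔ InImage (λ u → mod3 (col u) ≡ c) a
  parameters-columnClass σ zero             a = does-true (inImage? (inColumnClass? zero) a)
  parameters-columnClass σ (suc zero)       a = does-true (inImage? (inColumnClass? (suc zero)) a)
  parameters-columnClass σ (suc (suc zero)) a =
    does-true (inImage? (inColumnClass? (suc (suc zero))) a)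

  Image₂ : (Cell n → Cell n → Set) → V G → V G → Set
  Image₂ R a b = ∃₂ λ u v → a ≡ emb u × b ≡ emb v × R u v

  -- Through `Image₂`, satisfaction also forces both vertices to be cells. This keeps the
  -- quantifiers of the formulas inside the image of `emb`, whatever other vertices the graph has.
  Defines : ∀ {k} → BinaryFormula k → (Fin k → V G → Bool) → (Cell n → Cell n → Set) → Set
  Defines φ σ R = ∀ {i} (ρ : Fin i → V G) x y →
    Sat G ρ σ (φ x y) ⇔ Image₂ R (ρ x) (ρ y)

  -- Correctness is asked only for consecutive residue classes, since adjacency cannot express
  -- nearness everywhere: the bipartite graphs have no edges between columns of equal parity, and no
  -- graph has loops.
  DefinesNear : ∀ {k} → BinaryFormula k → (Fin k → V G → Bool) → Set
  DefinesNear near σ = ∀ {i} (ρ : Fin i → V G) x y u v → ρ x ≡ emb u → ρ y ≡ emb v →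
    NextClass u v → Sat G ρ σ (near x y) ⇔ Near u v

  module _ {k} (near : BinaryFormula (4 + k)) (σ : Fin (4 + k) → V G → Bool)
           (emb-injective : Injective _≡_ _≡_ emb)
           (class-defined : ∀ c a → σ (columnClass c) a ≡ true ⇔ InImage (λ u → mod3 (col u) ≡ c) a)
           (domain-defined : ∀ a → σ gridDomain a ≡ true ⇔ InImage (λ u → col u < n) a)
           (near-defined : DefinesNear near σ) where

    nextClass-defined : Defines nextClass σ NextClass
    nextClass-defined ρ x y = mk⇔
      [ step zero , [ step (suc zero) , step (suc (suc zero)) ] ]
      (λ (u , v , xu , yv , label) → unstep (mod3 (col u)) u v xu yv refl label)
      where
      step : ∀ c → σ (columnClass c) (ρ x) ≡ true × σ (columnClass (rotate c)) (ρ y) ≡ true →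
             Image₂ NextClass (ρ x) (ρ y)
      step c (cx , cy)
        with u , xu , refl ← class-defined c (ρ x) .to cx
           | v , yv , lv ← class-defined (rotate c) (ρ y) .to cy
           = u , v , xu , yv , lv

      both : ∀ c u v → ρ x ≡ emb u → ρ y ≡ emb v → mod3 (col u) ≡ c → mod3 (col v) ≡ rotate c →
             σ (columnClass c) (ρ x) ≡ true × σ (columnClass (rotate c)) (ρ y) ≡ true
      both c u v xu yv lu lv =
        class-defined c (ρ x) .from (u , xu , lu) ,
        class-defined (rotate c) (ρ y) .from (v , yv , lv)

      unstep : ∀ c u v → ρ x ≡ emb u → ρ y ≡ emb v → mod3 (col u) ≡ c →
               NextClass u v → Sat G ρ σ (nextClass x y)
      unstep zero             u v xu yv lu label =
        inj₁ (both zero u v xu yv lu (trans label (cong rotate lu)))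
      unstep (suc zero)       u v xu yv lu label =
        inj₂ (inj₁ (both (suc zero) u v xu yv lu (trans label (cong rotate lu))))
      unstep (suc (suc zero)) u v xu yv lu label =
        inj₂ (inj₂ (both (suc (suc zero)) u v xu yv lu (trans label (cong rotate lu))))

    nextBelow-defined : Defines (nextBelow near) σ NextBelow
    nextBelow-defined ρ x y = mk⇔
      (λ (c , h) → let (u , v , xu , yv , label) = nextClass-defined ρ x y .to c in
        u , v , xu , yv , near⇒nextBelow u v label (near-defined ρ x y u v xu yv label .to h))
      λ (u , v , xu , yv , h) → let label = cong mod3 (proj₁ h) in
        nextClass-defined ρ x y .from (u , v , xu , yv , label) ,
        near-defined ρ x y u v xu yv label .from (nextBelow⇒near u v h)

    nextBelow-emb : ∀ {i} (ρ : Fin i → V G) x y {u v} → ρ x ≡ emb u → ρ y ≡ emb v →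
                    Sat G ρ σ (nextBelow near x y) ⇔ NextBelow u v
    nextBelow-emb ρ x y {u} {v} xu yv = mk⇔
      (λ s → let (u' , v' , xu' , yv' , h) = nextBelow-defined ρ x y .to s in
        subst₂ NextBelow (emb-injective (trans (sym xu') xu)) (emb-injective (trans (sym yv') yv)) h)
      λ h → nextBelow-defined ρ x y .from (u , v , xu , yv , h)

    -- The common neighbour `b` puts `u` and `v` in one column. The vertex `a` lies in the next
    -- column, no higher than `v`; if `v` were no higher than `u`, then `a` would be related to `u`
    -- too.
    below⇒Below : ∀ {i} (ρ : Fin i → V G) x y → Sat G ρ σ (below near x y) →
                  Image₂ Below (ρ x) (ρ y)
    below⇒Below ρ x y ((a , ya , ¬xa) , (b , xb , yb))
      with v , w , yv , aw , (cw , rw) ← nextBelow-defined (extend a ρ) (suc y) zero .to ya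
         | u , z , xu , bz , (cz , rz) ← nextBelow-defined (extend b ρ) (suc x) zero .to xb
         | v' , z' , yv' , bz' , (cz' , _) ← nextBelow-defined (extend b ρ) (suc y) zero .to yb
      with refl ← emb-injective (trans (sym yv) yv') | refl ← emb-injective (trans (sym bz) bz')
      = u , v , xu , yv , same , ≰⇒> λ v≤u → ¬xa
          (nextBelow-emb (extend a ρ) (suc x) zero xu aw .from
            (trans cw (cong suc (sym same)) , ≤-trans rw v≤u))
      where
      same : col u ≡ col v
      same = suc-injective (trans (sym cz) cz')

    below-emb : ∀ {i} (ρ : Fin i → V G) x y {u v} → ρ x ≡ emb u → ρ y ≡ emb v →
                Sat G ρ σ (below near x y) → Below u v
    below-emb ρ x y xu yv s
      with u' , v' , xu' , yv' , h ← below⇒Below ρ x y s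
      with refl ← emb-injective (trans (sym xu) xu') | refl ← emb-injective (trans (sym yv) yv') = h

    -- The bound `col u < n` provides a next column. Its cell `w` in the row of `v` separates the
    -- two neighbourhoods, and its cell `z` in the row of `u` belongs to both.
    Below⇒below : ∀ {i} (ρ : Fin i → V G) x y {u v} → ρ x ≡ emb u → ρ y ≡ emb v →
                  col u < n → Below u v → Sat G ρ σ (below near x y)
    Below⇒below ρ x y {u} {v} xu yv u<n (same , u<v) =
      (emb w ,
        nextBelow-emb (extend (emb w) ρ) (suc y) zero yv refl .from (colw , ≤-refl) ,
        λ s → <⇒≱ u<v (proj₂ (nextBelow-emb (extend (emb w) ρ) (suc x) zero xu refl .to s))) ,
      (emb z ,
        nextBelow-emb (extend (emb z) ρ) (suc x) zero xu refl .from (trans colw (cong suc (sym same)) , ≤-refl) ,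
        nextBelow-emb (extend (emb z) ρ) (suc y) zero yv refl .from (colw , <⇒≤ u<v))
      where
      i⁺ : Fin (suc n)
      i⁺ = fromℕ< (s≤s u<n)
      w z : Cell n
      w = i⁺ , proj₂ v
      z = i⁺ , proj₂ u
      colw : toℕ i⁺ ≡ suc (col v)
      colw = trans (Finₚ.toℕ-fromℕ< (s≤s u<n)) (cong suc same)

    rowSuccessor-emb : ∀ {i} (ρ : Fin i → V G) x y {u v} → ρ x ≡ emb u → ρ y ≡ emb v →
      col u < n → Sat G ρ σ (rowSuccessor near x y) ⇔ RowSuccessor u v
    rowSuccessor-emb ρ x y {u} {v} xu yv u<n = mk⇔
      (λ (s , none) → below-cover u v (below-emb ρ x y xu yv s) λ w u<w w<v → none (emb w ,
        Below⇒below (extend (emb w) ρ) (suc x) zero xu refl u<n u<w ,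
        Below⇒below (extend (emb w) ρ) zero (suc y) refl yv (subst (_< n) (proj₁ u<w) u<n) w<v))
      (λ h@(same , eq) → Below⇒below ρ x y xu yv u<n (same , ≤-reflexive (sym eq)) ,
        λ (a , s , s') → between a h (below⇒Below (extend a ρ) (suc x) zero s) s')
      where
      between : ∀ a → RowSuccessor u v → Image₂ Below (ρ x) a →
                ¬ Sat G (extend a ρ) σ (below near zero (suc y))
      between a h (u' , w , xu' , aw , u<w) s =
        below-empty u v w h (subst (λ u → Below u w) (emb-injective (trans (sym xu') xu)) u<w)
          (below-emb (extend a ρ) zero (suc y) aw yv s)

    -- The bound concerns the column of `v`, because maximality is expressed by `below` inside that
    -- column.
    columnSuccessor-emb : ∀ {i} (ρ : Fin i → V G) x y {u v} → ρ x ≡ emb u → ρ y ≡ emb v →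
      col v < n → Sat G ρ σ (columnSuccessor near x y) ⇔ ColumnSuccessor u v
    columnSuccessor-emb ρ x y {u} {v} xu yv v<n = mk⇔
      (λ (s , none) → nextBelow-max u v (nextBelow-emb ρ x y xu yv .to s) λ w u<w v<w → none (emb w ,
        nextBelow-emb (extend (emb w) ρ) (suc x) zero xu refl .from u<w ,
        Below⇒below (extend (emb w) ρ) (suc y) zero yv refl v<n v<w))
      (λ h@(eq , next) → nextBelow-emb ρ x y xu yv .from (next , ≤-reflexive (sym eq)) ,
        λ (a , s , s') → between a h (below⇒Below (extend a ρ) (suc y) zero s') s)
      where
      between : ∀ a → ColumnSuccessor u v → Image₂ Below (ρ y) a →
                ¬ Sat G (extend a ρ) σ (nextBelow near (suc x) zero)
      between a (eq , _) (v' , w , yv' , aw , v<w) s =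
        <⇒≱ (proj₂ (subst (λ v → Below v w) (emb-injective (trans (sym yv') yv)) v<w))
          (≤-trans (proj₂ (nextBelow-emb (extend a ρ) (suc x) zero xu aw .to s)) (≤-reflexive eq))

    gridCell : Fin n × Fin n → Cell n
    gridCell (i , j) = inject₁ i , j

    gridCell-col : ∀ u → col (gridCell u) ≡ toℕ (proj₁ u)
    gridCell-col (i , _) = Finₚ.toℕ-inject₁ i

    gridCell-col<n : ∀ u → col (gridCell u) < n
    gridCell-col<n u@(i , _) = subst (_< n) (sym (gridCell-col u)) (Finₚ.toℕ<n i)

    gridCell-injective : Injective _≡_ _≡_ gridCell
    gridCell-injective {i , _} {i' , _} eq =
      cong₂ _,_ (Finₚ.inject₁-injective (cong proj₁ eq)) (cong proj₂ eq)

    gridAdj⇔ : ∀ u v → GridAdj u v ⇔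
      ((RowSuccessor (gridCell u) (gridCell v) ⊎ RowSuccessor (gridCell v) (gridCell u)) ⊎
       (ColumnSuccessor (gridCell u) (gridCell v) ⊎ ColumnSuccessor (gridCell v) (gridCell u)))
    gridAdj⇔ (i , j) (i' , j') rewrite Finₚ.toℕ-inject₁ i | Finₚ.toℕ-inject₁ i' = mk⇔
      (λ where
        (inj₁ (refl , inj₁ h)) → inj₁ (inj₁ (refl , h))
        (inj₁ (refl , inj₂ h)) → inj₁ (inj₂ (refl , h))
        (inj₂ (refl , inj₁ h)) → inj₂ (inj₁ (refl , h))
        (inj₂ (refl , inj₂ h)) → inj₂ (inj₂ (refl , h)))
      (λ where
        (inj₁ (inj₁ (e , h))) → inj₁ (Finₚ.toℕ-injective e , inj₁ h)
        (inj₁ (inj₂ (e , h))) → inj₁ (Finₚ.toℕ-injective (sym e) , inj₂ h)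
        (inj₂ (inj₁ (e , h))) → inj₂ (Finₚ.toℕ-injective e , inj₁ h)
        (inj₂ (inj₂ (e , h))) → inj₂ (Finₚ.toℕ-injective (sym e) , inj₂ h))

    gridEdge-defined : ∀ u v → GridAdj u v ⇔
      Sat G (env2 (emb (gridCell u)) (emb (gridCell v))) σ (gridEdge near zero (suc zero))
    gridEdge-defined u v = ⇔-trans (gridAdj⇔ u v) (⇔-sym
      ((rowStep zero one refl refl u<n ⊎-⇔ rowStep one zero refl refl v<n) ⊎-⇔
       (columnStep zero one refl refl v<n ⊎-⇔ columnStep one zero refl refl u<n)))
      where
      one : Fin 2
      one = suc zero
      ρ = env2 (emb (gridCell u)) (emb (gridCell v))
      rowStep = rowSuccessor-emb ρ
      columnStep = columnSuccessor-emb ρ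
      u<n = gridCell-col<n u
      v<n = gridCell-col<n v

    gridCopy : GridCopy (gridInterpretation near) G σ n
    gridCopy =
      emb ∘ gridCell , gridCell-injective ∘ emb-injective , inDomain , onlyDomain , gridEdge-defined
      where
      inDomain : ∀ u → σ gridDomain (emb (gridCell u)) ≡ true
      inDomain u = domain-defined (emb (gridCell u)) .from (gridCell u , refl , gridCell-col<n u)

      onlyDomain : ∀ a → σ gridDomain a ≡ true → ∃ λ u → emb (gridCell u) ≡ a
      onlyDomain a h with (i , j) , refl , i<n ← domain-defined a .to h =
        (fromℕ< i<n , j) , cong (λ i → emb (i , j)) (Finₚ.toℕ-injective
          (trans (Finₚ.toℕ-inject₁ _) (Finₚ.toℕ-fromℕ< i<n)))

interpretsGrids : ∀ {k} {𝒞 : Graph → Set} (near : BinaryFormula (4 + k)) →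
  (∀ m → Σ Graph λ G → 𝒞 G × Σ (Cell (suc m) → V G) λ emb → Injective _≡_ _≡_ emb ×
     Σ (Fin k → V G → Bool) λ σ → DefinesNear G emb near (parameters G emb σ)) →
  InterpretsGrids 𝒞
-- Only positive sizes are used; the unit interval construction divides by the size.
interpretsGrids near construct = _ , gridInterpretation near , λ m →
  let (G , G∈𝒞 , emb , emb-injective , σ , near-defined) = construct m in
  suc m , n≤1+n m , G , G∈𝒞 , parameters G emb σ ,
  gridCopy G emb near (parameters G emb σ) emb-injective (parameters-columnClass G emb σ)
    (λ a → does-true (inImage? G emb (inGrid? G emb) a)) near-defined

-- Permutation graphs from keys in a linear order.

Disagree : ∀ {A V : Set} → (A → A → Set) → (V → A) → (V → A) → V → V → Set
Disagree _≺_ p q u v = (p u ≺ p v × q v ≺ q u) ⊎ (p v ≺ p u × q u ≺ q v)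

module _ {A : Set} {_≺_ : A → A → Set} (≺-order : IsStrictTotalOrder _≡_ _≺_) where
  open IsStrictTotalOrder ≺-order using (compare; irrefl) renaming (trans to ≺-trans; _<?_ to _≺?_)

  module Disagreement {V : Set} (p q : V → A) where

    disagree? : ∀ u v → Dec (Disagree _≺_ p q u v)
    disagree? u v = ((p u ≺? p v) ×-dec (q v ≺? q u)) ⊎-dec ((p v ≺? p u) ×-dec (q u ≺? q v))

    disagree-sym : ∀ u v → Disagree _≺_ p q u v → Disagree _≺_ p q v u
    disagree-sym _ _ = Sum.swap

    disagree-irrefl : ∀ v → ¬ Disagree _≺_ p q v v
    disagree-irrefl v = [ irrefl refl ∘ proj₁ , irrefl refl ∘ proj₁ ]

  module Rank {s} (key : Fin s → A) (key-injective : Injective _≡_ _≡_ key) where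

    predecessors : Fin s → Subset s
    predecessors v = tabulate λ u → does (key u ≺? key v)

    ∈-predecessors : ∀ {u v} → u ∈ predecessors v ⇔ key u ≺ key v
    ∈-predecessors {u} {v} = mk⇔
      (λ h → does-true (key u ≺? key v) .to (trans (sym (lookup∘tabulate _ u)) ([]=⇒lookup h)))
      (λ h → lookup⇒[]= u (predecessors v) (trans (lookup∘tabulate _ u) (does-true (key u ≺? key v) .from h)))

    ∉-predecessors : ∀ {v} → ¬ v ∈ predecessors v
    ∉-predecessors h = irrefl refl (∈-predecessors .to h)

    -- The number of smaller keys. It is less than `s` because `v` does not precede itself, and the
    -- same observation about `u` makes the inclusion of predecessors in `rank-mono` strict.
    rank : Fin s → Fin s
    rank v = fromℕ< (subst (∣ predecessors v ∣ <_) (∣⊤∣≡n s)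
      (p⊂q⇒∣p∣<∣q∣ ((λ _ → ∈⊤) , v , ∈⊤ , ∉-predecessors {v})))

    rank-mono : ∀ {u v} → key u ≺ key v → rank u Fin.< rank v
    rank-mono {u} {v} u≺v = subst₂ _<_ (sym (Finₚ.toℕ-fromℕ< _)) (sym (Finₚ.toℕ-fromℕ< _))
      (p⊂q⇒∣p∣<∣q∣ ((λ h → ∈-predecessors .from (≺-trans (∈-predecessors .to h) u≺v)) ,
        u , ∈-predecessors .from u≺v , ∉-predecessors {u}))

    rank-injective : Injective _≡_ _≡_ rank
    rank-injective {u} {v} eq with compare (key u) (key v)
    ... | tri< u≺v _ _ = contradiction (cong toℕ eq) (<⇒≢ (rank-mono u≺v))
    ... | tri≈ _ k≡ _  = key-injective k≡
    ... | tri> _ _ v≺u = contradiction (cong toℕ (sym eq)) (<⇒≢ (rank-mono v≺u))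

    rank-⇔ : ∀ u v → key u ≺ key v ⇔ rank u Fin.< rank v
    rank-⇔ u v = mk⇔ rank-mono reflect
      where
      reflect : rank u Fin.< rank v → key u ≺ key v
      reflect h with compare (key u) (key v)
      ... | tri< u≺v _ _ = u≺v
      ... | tri≈ _ k≡ _  = contradiction (cong (toℕ ∘ rank) (key-injective k≡)) (<⇒≢ h)
      ... | tri> _ _ v≺u = contradiction (rank-mono v≺u) (<-asym h)

  -- Ranks compress arbitrary distinct keys to positions in `Fin (size G)` and preserve both orders,
  -- hence also disagreement.
  permutation : (G : Graph) (p q : V G → A) → Injective _≡_ _≡_ p → Injective _≡_ _≡_ q →
    (∀ u v → Edge G u v ⇔ Disagree _≺_ p q u v) → Permutation G
  permutation G p q p-injective q-injective edge⇔ =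
    P.rank , Q.rank , P.rank-injective , Q.rank-injective , λ u v →
      ⇔-trans (edge⇔ u v)
        ((P.rank-⇔ u v ×-⇔ Q.rank-⇔ v u) ⊎-⇔ (P.rank-⇔ v u ×-⇔ Q.rank-⇔ u v))
    where
    module P = Rank p p-injective
    module Q = Rank q q-injective

-- Graphs on a finite set of structured vertices.

module _ {W : Set} {s} (code : Fin s ↔ W) {E : W → W → Set} (E? : ∀ u v → Dec (E u v))
         (E-sym : ∀ u v → E u v → E v u) (E-irrefl : ∀ v → ¬ E v v) where
  open Inverse code renaming (to to decode; from to encode)

  graph : Graph
  graph = record
    { size    = s
    ; adj     = λ u v → does (E? (decode u) (decode v))
    ; adj-sym = λ u v → does-⇔ (mk⇔ (E-sym _ _) (E-sym _ _)) (E? _ _) (E? _ _)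
    ; adj-irr = λ v → dec-false (E? _ _) (E-irrefl (decode v))
    }

  edge-decode : ∀ u v → Edge graph u v ⇔ E (decode u) (decode v)
  edge-decode u v = does-true (E? (decode u) (decode v))

  edge-encode : ∀ w w' → Edge graph (encode w) (encode w') ⇔ E w w'
  edge-encode w w' = subst₂ (λ a b → Edge graph (encode w) (encode w') ⇔ E a b)
    (strictlyInverseˡ w) (strictlyInverseˡ w') (edge-decode (encode w) (encode w'))

encode-injective : ∀ {W : Set} {s} (code : Fin s ↔ W) → Injective _≡_ _≡_ (Inverse.from code)
encode-injective code {w} {w'} eq =
  trans (sym (Inverse.strictlyInverseˡ code w)) (trans (cong (Inverse.to code) eq) (Inverse.strictlyInverseˡ code w'))

decode-injective : ∀ {W : Set} {s} (code : Fin s ↔ W) → Injective _≡_ _≡_ (Inverse.to code)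
decode-injective code {u} {v} eq =
  trans (sym (Inverse.strictlyInverseʳ code u)) (trans (cong (Inverse.from code) eq) (Inverse.strictlyInverseʳ code v))

-- Comparison of even and odd keys.

odd<even : ∀ {a b} → suc (2 * b) < 2 * a ⇔ b < a
odd<even {a} {b} = mk⇔ (λ h → *-cancelˡ-< 2 b a (<-trans (n<1+n _) h))
  (λ h → subst (_≤ 2 * a) (*-suc 2 b) (*-monoʳ-≤ 2 h))

-- An odd key stands for a half-integer: a comparison with an even key never ties, and it is weak or
-- strict on the halves according to which side is odd.
even<odd : ∀ {a b} → 2 * a < suc (2 * b) ⇔ a ≤ b
even<odd = mk⇔ (λ h → *-cancelˡ-≤ 2 (s≤s⁻¹ h)) (λ h → s≤s (*-monoʳ-≤ 2 h))

-- Bipartite permutation graphs.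

module BipartitePermutationGrid (n : ℕ) where

  even : ℕ → Bool
  even zero    = true
  even (suc i) = not (even i)

  shiftedKey : Bool → ℕ → ℕ
  shiftedKey true  t = 2 * t
  shiftedKey false t = suc (2 * (t + n))

  -- The parity of the column decides in which of the two orders a vertex is delayed by n + 1/2.
  leftKey rightKey : Cell n → ℕ
  leftKey  u = shiftedKey (even (col u)) (pos u)
  rightKey u = shiftedKey (not (even (col u))) (pos u)

  open Disagreement <-isStrictTotalOrder leftKey rightKey

  pos-injective : Injective _≡_ _≡_ (pos {n})
  pos-injective {i , j} {i' , j'} eq = uncurry (cong₂ _,_) (Finₚ.combine-injective i j i' j'
    (Finₚ.toℕ-injective (trans (Finₚ.toℕ-combine i j) (trans eq (sym (Finₚ.toℕ-combine i' j'))))))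

  shiftedKey-injective : ∀ b b' {t t'} → shiftedKey b t ≡ shiftedKey b' t' → b ≡ b'  × t ≡ t'
  shiftedKey-injective true  true  eq = refl , *-cancelˡ-≡ _ _ 2 eq
  shiftedKey-injective true  false {t} {t'} eq = contradiction eq (even≢odd t (t' + n))
  shiftedKey-injective false true  {t} {t'} eq = contradiction (sym eq) (even≢odd t' (t + n))
  shiftedKey-injective false false eq =
    refl , +-cancelʳ-≡ n _ _ (*-cancelˡ-≡ _ _ 2 (suc-injective eq))

  shiftedKey-mono : ∀ b t t' → shiftedKey b t < shiftedKey b t' → t < t'
  shiftedKey-mono true  _ _ h = *-cancelˡ-< 2 _ _ h
  shiftedKey-mono false _ _ h = +-cancelʳ-< n _ _ (*-cancelˡ-< 2 _ _ (s≤s⁻¹ h))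

  -- For equal parities both orders follow the position, so they agree. For different parities the
  -- undelayed vertex comes first in each order exactly when the positions differ by at most `n`;
  -- the opposite inversion would put each position more than `n` ahead of the other.
  disagree-keys : ∀ b b' t t' →
    ((shiftedKey b t < shiftedKey b' t' × shiftedKey (not b') t' < shiftedKey (not b) t) ⊎
    (shiftedKey b' t' < shiftedKey b t × shiftedKey (not b) t < shiftedKey (not b') t')) ⇔
    (b ≢ b' × t' ≤ t + n × t ≤ t' + n)
  disagree-keys true true t t' = mk⇔
    [ (λ (p , q) → contradiction (shiftedKey-mono true t t' p) (<-asym (shiftedKey-mono false t' t q)))
    , (λ (p , q) → contradiction (shiftedKey-mono true t' t p) (<-asym (shiftedKey-mono false t t' q))) ]
    (λ (b≢b' , _) → contradiction refl b≢b')
  disagree-keys false false t t' = mk⇔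
    [ (λ (p , q) → contradiction (shiftedKey-mono false t t' p) (<-asym (shiftedKey-mono true t' t q)))
    , (λ (p , q) → contradiction (shiftedKey-mono false t' t p) (<-asym (shiftedKey-mono true t t' q))) ]
    (λ (b≢b' , _) → contradiction refl b≢b')
  disagree-keys true false t t' = mk⇔
    [ (λ (p , q) → (λ ()) , even<odd .to q , even<odd .to p)
    , (λ (p , q) → contradiction (m+n≤o⇒m≤o t (<⇒≤ (odd<even {t'} .to q))) (<⇒≱ (≤-<-trans (m≤m+n t' n) (odd<even .to p)))) ]
    (λ (_ , h , h') → inj₁ (even<odd .from h' , even<odd .from h))
  disagree-keys false true t t' = mk⇔
    [ (λ (p , q) → contradiction (m+n≤o⇒m≤o t (<⇒≤ (odd<even {t'} .to p))) (<⇒≱ (≤-<-trans (m≤m+n t' n) (odd<even .to q))))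
    , (λ (p , q) → (λ ()) , even<odd .to p , even<odd .to q) ]
    (λ (_ , h , h') → inj₂ (even<odd .from h , even<odd .from h'))

  disagree⇔ : ∀ u v → Disagree _<_ leftKey rightKey u v ⇔ (even (col u) ≢ even (col v) × Near u v)
  disagree⇔ u v = disagree-keys (even (col u)) (even (col v)) (pos u) (pos v)

  code : Fin (suc n * n) ↔ Cell n
  code = Finₚ.*↔×

  G : Graph
  G = graph code disagree? disagree-sym disagree-irrefl

  leftKey-injective : Injective _≡_ _≡_ leftKey
  leftKey-injective {u} {v} eq =
    pos-injective (proj₂ (shiftedKey-injective (even (col u)) (even (col v)) eq))

  rightKey-injective : Injective _≡_ _≡_ rightKey
  rightKey-injective {u} {v} eq =
    pos-injective (proj₂ (shiftedKey-injective (not (even (col u))) (not (even (col v))) eq))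

  G-edge = edge-decode code disagree? disagree-sym disagree-irrefl

  bipartitePermutation : BipartitePermutation G
  bipartitePermutation =
    (even ∘ col ∘ decode , λ u v e → proj₁ (disagree⇔ (decode u) (decode v) .to (G-edge u v .to e))) ,
    permutation <-isStrictTotalOrder G (leftKey ∘ decode) (rightKey ∘ decode)
      (decode-injective code ∘ leftKey-injective) (decode-injective code ∘ rightKey-injective) G-edge
    where decode = Inverse.to code

  even-suc : ∀ i → even i ≢ even (suc i)
  even-suc i eq with even i
  even-suc i () | true
  even-suc i () | false

  near-edge : ∀ u v → NextClass u v → Edge G (Inverse.from code u) (Inverse.from code v) ⇔ Near u v
  near-edge u v label = ⇔-trans (edge-encode code disagree? disagree-sym disagree-irrefl u v)
    (mk⇔ (λ e → proj₂ (disagree⇔ u v .to e))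
         -- Near cells of consecutive classes lie in consecutive columns, whose parities differ.
         (λ h → disagree⇔ u v .from
           ((λ eq → even-suc (col u) (trans eq (cong even (proj₁ (near⇒nextBelow u v label h))))) , h)))

bipartitePermutation-interpretsGrids : InterpretsGrids BipartitePermutation
bipartitePermutation-interpretsGrids = interpretsGrids {0} edge λ m →
  let open BipartitePermutationGrid (suc m) in
  G , bipartitePermutation , Inverse.from code , encode-injective code , (λ ()) ,
  λ ρ x y u v xu yv label → subst₂ (λ a b → Edge G a b ⇔ Near u v) (sym xu) (sym yv) (near-edge u v label)

-- Graphs of four chains: split permutation graphs and bichain graphs.

far near : ∀ {k} → Fin k → Fin k → Fin k → BinaryFormula k
far B₀ A₁ B₁ x y =
  -- The bound variables 2, 1 and 0 are the vertices chosen in `B₀`, `A₁` and `B₁`; `x` and `y` are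
  -- weakened past all three.
  ex (ex (ex (and (and (member 2F B₀) (and (member 1F A₁) (member 0F B₁)))
    (and (and (neg (edge (suc (suc (suc x))) 2F)) (edge 1F 2F))
         (and (neg (edge 1F 0F)) (edge (suc (suc (suc y))) 0F))))))
near B₀ A₁ B₁ x y = and (neg (far B₀ A₁ B₁ x y)) (neg (far B₀ A₁ B₁ y x))

module FourChains (n : ℕ) where

  M : ℕ
  M = suc n * n

  -- (side , chain , position): sides A = 0F and B = 1F, each with chains 0F and 1F.
  W : Set
  W = Fin 2 × Fin 2 × Fin M

  -- In the plane with coordinates leftKey and rightKey the four chains are the arms of
  -- a cross: A descends, B ascends, and consecutive chains in the cycle A₀ B₀ A₁ B₁
  -- overlap in exactly one coordinate.  Even keys on A and odd keys on B exclude ties.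
  leftKey rightKey : W → ℤ
  leftKey  (0F , 0F , t) = pos⁺ (2 * toℕ t)
  leftKey  (0F , 1F , t) = -[1+ 2 * toℕ t ]
  leftKey  (1F , 0F , t) = pos⁺ (suc (2 * toℕ t))
  leftKey  (1F , 1F , t) = -[1+ suc (2 * toℕ t) ]
  rightKey (0F , 0F , t) = -[1+ 2 * toℕ t ]
  -- The successor makes the comparison between A₁ and B₀ weak, so that equal positions are adjacent
  -- there.
  rightKey (0F , 1F , t) = pos⁺ (2 * suc (toℕ t))
  rightKey (1F , 0F , t) = pos⁺ (suc (2 * toℕ t))
  -- This delay produces the shift by `n` between A₀ and B₁.
  rightKey (1F , 1F , t) = -[1+ suc (2 * (toℕ t + n)) ]

  open Disagreement ℤₚ.<-isStrictTotalOrder leftKey rightKey public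

  same-position : ∀ {s c : Fin 2} {t t' : Fin M} → toℕ t ≡ toℕ t' → _≡_ {A =
    W} (s , c , t) (s , c , t')
  same-position {s} {c} eq = cong (λ t → s , c , t) (Finₚ.toℕ-injective eq)

  leftKey-injective : Injective _≡_ _≡_ leftKey
  leftKey-injective {0F , 0F , t} {0F , 0F , t'} eq =
    same-position (*-cancelˡ-≡ _ _ 2 (ℤₚ.+-injective eq))
  leftKey-injective {0F , 0F , t} {1F , 0F , t'} eq =
    contradiction (ℤₚ.+-injective eq) (even≢odd (toℕ t) (toℕ t'))
  leftKey-injective {0F , 1F , t} {0F , 1F , t'} eq =
    same-position (*-cancelˡ-≡ _ _ 2 (ℤₚ.-[1+-injective eq))
  leftKey-injective {0F , 1F , t} {1F , 1F , t'} eq =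
    contradiction (ℤₚ.-[1+-injective eq) (even≢odd (toℕ t) (toℕ t'))
  leftKey-injective {1F , 0F , t} {0F , 0F , t'} eq =
    contradiction (ℤₚ.+-injective (sym eq)) (even≢odd (toℕ t') (toℕ t))
  leftKey-injective {1F , 0F , t} {1F , 0F , t'} eq =
    same-position (*-cancelˡ-≡ _ _ 2 (suc-injective (ℤₚ.+-injective eq)))
  leftKey-injective {1F , 1F , t} {0F , 1F , t'} eq =
    contradiction (ℤₚ.-[1+-injective (sym eq)) (even≢odd (toℕ t') (toℕ t))
  leftKey-injective {1F , 1F , t} {1F , 1F , t'} eq =
    same-position (*-cancelˡ-≡ _ _ 2 (suc-injective (ℤₚ.-[1+-injective eq)))
  leftKey-injective {0F , 0F , _} {0F , 1F , _} ()
  leftKey-injective {0F , 0F , _} {1F , 1F , _} ()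
  leftKey-injective {1F , 0F , _} {0F , 1F , _} ()
  leftKey-injective {1F , 0F , _} {1F , 1F , _} ()
  leftKey-injective {0F , 1F , _} {0F , 0F , _} ()
  leftKey-injective {0F , 1F , _} {1F , 0F , _} ()
  leftKey-injective {1F , 1F , _} {0F , 0F , _} ()
  leftKey-injective {1F , 1F , _} {1F , 0F , _} ()

  rightKey-injective : Injective _≡_ _≡_ rightKey
  rightKey-injective {0F , 0F , t} {0F , 0F , t'} eq =
    same-position (*-cancelˡ-≡ _ _ 2 (ℤₚ.-[1+-injective eq))
  rightKey-injective {0F , 0F , t} {1F , 1F , t'} eq =
    contradiction (ℤₚ.-[1+-injective eq) (even≢odd (toℕ t) (toℕ t' + n))
  rightKey-injective {0F , 1F , t} {0F , 1F , t'} eq =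
    same-position (suc-injective (*-cancelˡ-≡ _ _ 2 (ℤₚ.+-injective eq)))
  rightKey-injective {0F , 1F , t} {1F , 0F , t'} eq =
    contradiction (ℤₚ.+-injective eq) (even≢odd (suc (toℕ t)) (toℕ t'))
  rightKey-injective {1F , 0F , t} {0F , 1F , t'} eq =
    contradiction (ℤₚ.+-injective (sym eq)) (even≢odd (suc (toℕ t')) (toℕ t))
  rightKey-injective {1F , 0F , t} {1F , 0F , t'} eq =
    same-position (*-cancelˡ-≡ _ _ 2 (suc-injective (ℤₚ.+-injective eq)))
  rightKey-injective {1F , 1F , t} {0F , 0F , t'} eq =
    contradiction (ℤₚ.-[1+-injective (sym eq)) (even≢odd (toℕ t') (toℕ t + n))
  rightKey-injective {1F , 1F , t} {1F , 1F , t'} eq =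
    same-position (+-cancelʳ-≡ n _ _ (*-cancelˡ-≡ _ _ 2 (suc-injective (ℤₚ.-[1+-injective eq))))
  rightKey-injective {0F , 0F , _} {0F , 1F , _} ()
  rightKey-injective {0F , 0F , _} {1F , 0F , _} ()
  rightKey-injective {1F , 1F , _} {0F , 1F , _} ()
  rightKey-injective {1F , 1F , _} {1F , 0F , _} ()
  rightKey-injective {0F , 1F , _} {0F , 0F , _} ()
  rightKey-injective {1F , 0F , _} {0F , 0F , _} ()
  rightKey-injective {0F , 1F , _} {1F , 1F , _} ()
  rightKey-injective {1F , 0F , _} {1F , 1F , _} ()

  _#_ : W → W → Set
  _#_ = Disagree ℤ._<_ leftKey rightKey

  -- Adjacency of position a in chain c of A and position b in chain d of B.
  Cross : Fin 2 → Fin 2 → ℕ → ℕ → Set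
  Cross 0F 0F a b = b < a
  Cross 0F 1F a b = b + n < a
  Cross 1F 0F a b = b ≤ a
  Cross 1F 1F a b = b < a

  Cross-monoˡ : ∀ c d {a a' b} → a ≤ a' → Cross c d a b → Cross c d a' b
  Cross-monoˡ 0F 0F a≤a' h = <-≤-trans h a≤a'
  Cross-monoˡ 0F 1F a≤a' h = <-≤-trans h a≤a'
  Cross-monoˡ 1F 0F a≤a' h = ≤-trans h a≤a'
  Cross-monoˡ 1F 1F a≤a' h = <-≤-trans h a≤a'

  Cross-antimonoʳ : ∀ c d {a b b'} → b' ≤ b → Cross c d a b → Cross c d a b'
  Cross-antimonoʳ 0F 0F b'≤b h = ≤-<-trans b'≤b h
  Cross-antimonoʳ 0F 1F b'≤b h = ≤-<-trans (+-monoˡ-≤ n b'≤b) h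
  Cross-antimonoʳ 1F 0F b'≤b h = ≤-trans b'≤b h
  Cross-antimonoʳ 1F 1F b'≤b h = ≤-<-trans b'≤b h

  -- In one coordinate the two keys have opposite signs, which selects the possible inversion; the
  -- other coordinate compares an even with an odd key.
  #⇔Cross : ∀ c d a b → (0F , c , a) # (1F , d , b) ⇔ Cross c d (toℕ a) (toℕ b)
  #⇔Cross 0F 0F a b = mk⇔
    (λ { (inj₁ (_ , ())) ; (inj₂ (+<+ h , -<+)) → odd<even .to h })
    (λ h → inj₂ (+<+ (odd<even .from h) , -<+))
  #⇔Cross 0F 1F a b = mk⇔
    (λ { (inj₁ (() , _)) ; (inj₂ (-<+ , -<- h)) → odd<even .to h })
    (λ h → inj₂ (-<+ , -<- (odd<even .from h)))
  #⇔Cross 1F 0F a b = mk⇔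
    (λ { (inj₁ (-<+ , +<+ h)) → s≤s⁻¹ (odd<even .to h) ; (inj₂ (() , _)) })
    (λ h → inj₁ (-<+ , +<+ (odd<even .from (s≤s h))))
  #⇔Cross 1F 1F a b = mk⇔
    (λ { (inj₁ (-<- h , -<+)) → odd<even .to h ; (inj₂ (_ , ())) })
    (λ h → inj₁ (-<- (odd<even .from h) , -<+))

  code : Fin (2 * (2 * M)) ↔ W
  code = ↔-trans Finₚ.*↔× (↔-refl ×-↔ Finₚ.*↔×)

  open Inverse code renaming (to to decode; from to encode) public

  isB : Fin 2 → Bool
  isB 0F = false
  isB 1F = true

  isB-injective : ∀ s s' → isB s ≡ isB s' → s ≡ s'
  isB-injective 0F 0F _ = refl
  isB-injective 1F 1F _ = refl
  isB-injective 0F 1F ()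
  isB-injective 1F 0F ()

  side : Fin (2 * (2 * M)) → Bool
  side v = isB (proj₁ (decode v))

  chain : Fin (2 * (2 * M)) → Fin 2
  chain v = proj₁ (proj₂ (decode v))

  emb : Cell n → Fin (2 * (2 * M))
  emb (i , j) = encode (0F , 0F , combine i j)

  emb-injective : Injective _≡_ _≡_ emb
  emb-injective {i , j} {i' , j'} eq = uncurry (cong₂ _,_)
    (Finₚ.combine-injective i j i' j' (cong (proj₂ ∘ proj₂)
      (encode-injective code {0F , 0F , combine i j} {0F , 0F , combine i' j'} eq)))

  inChain? : ∀ s c v → Dec (proj₁ (decode v) ≡ s × chain v ≡ c)
  inChain? s c v = (proj₁ (decode v) Finₚ.≟ s) ×-dec (chain v Finₚ.≟ c)

  -- The three chains visited on the way around the cycle from A₀ back to A₀.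
  chains : Fin 3 → Fin (2 * (2 * M)) → Bool
  chains 0F v = does (inChain? 1F 0F v)
  chains 1F v = does (inChain? 0F 1F v)
  chains 2F v = does (inChain? 1F 1F v)

  inChain-encode : ∀ s c t → does (inChain? s c (encode (s , c , t))) ≡ true
  inChain-encode s c t = does-true (inChain? s c _) .from
    (cong proj₁ (strictlyInverseˡ (s , c , t)) , cong (proj₁ ∘ proj₂) (strictlyInverseˡ (s , c , t)))

  inChain-decode : ∀ s c v → does (inChain? s c v) ≡ true → ∃ λ t → v ≡ encode (s , c , t)
  inChain-decode s c v h with refl , refl ← does-true (inChain? s c v) .to h =
    proj₂ (proj₂ (decode v)) , sym (strictlyInverseʳ v)

  -- Only adjacency between the two sides is prescribed, so one argument serves both the split and
  -- the bipartite graph.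
  module FourChainGraph {E : W → W → Set} (E? : ∀ u v → Dec (E u v))
    (E-sym : ∀ u v → E u v → E v u) (E-irrefl : ∀ v → ¬ E v v)
    (E⇔Cross : ∀ c d a b → E (0F , c , a) (1F , d , b) ⇔ Cross c d (toℕ a) (toℕ b)) where

    G : Graph
    G = graph code E? E-sym E-irrefl

    cross : ∀ c d a b → Edge G (encode (0F , c , a)) (encode (1F , d , b)) ⇔ Cross c d (toℕ a) (toℕ b)
    cross c d a b = ⇔-trans (edge-encode code E? E-sym E-irrefl _ _) (E⇔Cross c d a b)

    -- The unfolded semantics of the formula `far`; `near-defined` relies on the two agreeing by
    -- computation.
    Far : V G → V G → Set
    Far x y = Σ (V G) λ b₀ → Σ (V G) λ a₁ → Σ (V G) λ b₁ →
      (chains 0F b₀ ≡ true × chains 1F a₁ ≡ true × chains 2F b₁ ≡ true) ×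
      ((¬ Edge G x b₀ × Edge G a₁ b₀) × (¬ Edge G a₁ b₁ × Edge G y b₁))

    -- The four edge conditions read `s ≤ b₀`, `b₀ ≤ a₁`, `a₁ ≤ b₁` and `b₁ + n < t`. Conversely,
    -- all three intermediate vertices can be taken at position `s`.
    far-⇔ : ∀ s t → Far (encode (0F , 0F , s)) (encode (0F , 0F , t)) ⇔ toℕ s + n < toℕ t
    far-⇔ s t = mk⇔ forward backward
      where
      forward : Far (encode (0F , 0F , s)) (encode (0F , 0F , t)) → toℕ s + n < toℕ t
      forward (b₀ , a₁ , b₁ , (hb₀ , ha₁ , hb₁) , (¬sb₀ , a₁b₀) , (¬a₁b₁ , tb₁))
        with b₀ , refl ← inChain-decode 1F 0F b₀ hb₀
           | a₁ , refl ← inChain-decode 0F 1F a₁ ha₁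
           | b₁ , refl ← inChain-decode 1F 1F b₁ hb₁ = begin-strict
        toℕ s + n   ≤⟨ +-monoˡ-≤ n (≮⇒≥ (¬sb₀ ∘ cross 0F 0F s b₀ .from)) ⟩
        toℕ b₀ + n  ≤⟨ +-monoˡ-≤ n (cross 1F 0F a₁ b₀ .to a₁b₀) ⟩
        toℕ a₁ + n  ≤⟨ +-monoˡ-≤ n (≮⇒≥ (¬a₁b₁ ∘ cross 1F 1F a₁ b₁ .from)) ⟩
        toℕ b₁ + n  <⟨ cross 0F 1F t b₁ .to tb₁ ⟩
        toℕ t       ∎
        where open ≤-Reasoning

      backward : toℕ s + n < toℕ t → Far (encode (0F , 0F , s)) (encode (0F , 0F , t))
      backward h = encode (1F , 0F , s) , encode (0F , 1F , s) , encode (1F , 1F , s) ,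
        (inChain-encode 1F 0F s , inChain-encode 0F 1F s , inChain-encode 1F 1F s) ,
        (<-irrefl refl ∘ cross 0F 0F s s .to , cross 1F 0F s s .from ≤-refl) ,
        (<-irrefl refl ∘ cross 1F 1F s s .to , cross 0F 1F t s .from h)

    near-⇔ : ∀ u v → (¬ Far (emb u) (emb v) × ¬ Far (emb v) (emb u)) ⇔ Near u v
    near-⇔ u v = notFar u v ×-⇔ notFar v u
      where
      toℕ-emb : ∀ u → toℕ (uncurry combine u) ≡ pos u
      toℕ-emb (i , j) = Finₚ.toℕ-combine i j
      notFar : ∀ u v → (¬ Far (emb u) (emb v)) ⇔ pos v ≤ pos u + n
      notFar u v = subst₂ (λ s t → (¬ Far (emb u) (emb v)) ⇔ t ≤ s + n) (toℕ-emb u) (toℕ-emb v)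
        (mk⇔ (λ h → ≮⇒≥ (h ∘ far-⇔ _ _ .from)) (λ h → ≤⇒≯ h ∘ far-⇔ _ _ .to))

    near-defined : DefinesNear G emb (near (extra 0F) (extra 1F) (extra 2F)) (parameters G emb chains)
    near-defined ρ x y u v xu yv _ = subst₂ (λ a b → (¬ Far a b × ¬ Far b a) ⇔ Near u v)
      (sym xu) (sym yv) (near-⇔ u v)

  module SplitPermutationGrid where

    open FourChainGraph disagree? disagree-sym disagree-irrefl #⇔Cross public

    -- All of A forms one descending sequence in the plane of the two keys, so any two of its points
    -- are inverted.
    A-clique : ∀ c c' t t' → (c , t) ≢ (c' , t') → (0F , c , t) # (0F , c' , t')
    A-clique 0F 0F t t' u≢v with <-cmp (toℕ t) (toℕ t')
    ... | tri< t<t' _ _ = inj₁ (+<+ (*-monoʳ-< 2 t<t') , -<- (*-monoʳ-< 2 t<t'))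
    ... | tri≈ _ t≡t' _ = contradiction (cong (0F ,_) (Finₚ.toℕ-injective t≡t')) u≢v
    ... | tri> _ _ t'<t = inj₂ (+<+ (*-monoʳ-< 2 t'<t) , -<- (*-monoʳ-< 2 t'<t))
    A-clique 0F 1F t t' _ = inj₂ (-<+ , -<+)
    A-clique 1F 0F t t' _ = inj₁ (-<+ , -<+)
    A-clique 1F 1F t t' u≢v with <-cmp (toℕ t) (toℕ t')
    ... | tri< t<t' _ _ = inj₂ (-<- (*-monoʳ-< 2 t<t') , +<+ (*-monoʳ-< 2 (s≤s t<t')))
    ... | tri≈ _ t≡t' _ = contradiction (cong (1F ,_) (Finₚ.toℕ-injective t≡t')) u≢v
    ... | tri> _ _ t'<t = inj₁ (-<- (*-monoʳ-< 2 t'<t) , +<+ (*-monoʳ-< 2 (s≤s t'<t)))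

    -- Both keys order B alike, with all of B₁ before all of B₀.
    B-monotone : ∀ c c' t t' → leftKey (1F , c , t) ℤ.< leftKey (1F , c' , t') →
                 ¬ rightKey (1F , c' , t') ℤ.< rightKey (1F , c , t)
    B-monotone 0F 0F t t' h h' = ℤₚ.<-asym h h'
    B-monotone 0F 1F t t' () h'
    B-monotone 1F 0F t t' h ()
    B-monotone 1F 1F t t' (-<- h) (-<- h') = <-asym h₁ (*-cancelˡ-< 2 _ _ (s≤s⁻¹ h))
      where
      h₁ : toℕ t < toℕ t'
      h₁ = +-cancelʳ-< n _ _ (*-cancelˡ-< 2 _ _ (s≤s⁻¹ h'))

    B-independent : ∀ c c' t t' → ¬ (1F , c , t) # (1F , c' , t')
    B-independent c c' t t' = [ uncurry (B-monotone c c' t t') , uncurry (B-monotone c' c t' t) ]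

    split : Split G
    split = not ∘ side , clique , independent
      where
      clique : ∀ u v → u ≢ v → not (side u) ≡ true → not (side v) ≡ true → Edge G u v
      clique u v u≢v hu hv = edge-decode code disagree? disagree-sym disagree-irrefl u v .from
        (on (decode u) (decode v) (u≢v ∘ decode-injective code) hu hv)
        where
        on : ∀ w w' → w ≢ w' → not (isB (proj₁ w)) ≡ true → not (isB (proj₁ w')) ≡ true → w # w'
        on (0F , c , t) (0F , c' , t') w≢w' _ _ = A-clique c c' t t' (w≢w' ∘ cong (0F ,_))
        on (0F , _) (1F , _) _ _ ()
        on (1F , _) _ _ ()
      independent : ∀ u v → not (side u) ≡ false → not (side v) ≡ false → ¬ Edge G u v
      independent u v hu hv e =
        on (decode u) (decode v) hu hv (edge-decode code disagree? disagree-sym disagree-irrefl u v .to e)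
        where
        on : ∀ w w' → not (isB (proj₁ w)) ≡ false → not (isB (proj₁ w')) ≡ false → ¬ w # w'
        on (1F , c , t) (1F , c' , t') _ _ = B-independent c c' t t'
        on (0F , _) _ ()
        on (1F , _) (0F , _) _ ()

    splitPermutation : SplitPermutation G
    splitPermutation =
      split , permutation ℤₚ.<-isStrictTotalOrder G (leftKey ∘ decode) (rightKey ∘ decode)
      (decode-injective code ∘ leftKey-injective) (decode-injective code ∘ rightKey-injective)
      (edge-decode code disagree? disagree-sym disagree-irrefl)

  module BichainGrid where

    -- Dropping the edges inside A from the split graph makes it bipartite and keeps the half graphs
    -- between the sides.
    _~_ : W → W → Set
    w ~ w' = proj₁ w ≢ proj₁ w' × w # w'

    _~?_ : ∀ w w' → Dec (w ~ w')
    w ~? w' = ¬? (proj₁ w Finₚ.≟ proj₁ w') ×-dec disagree? w w'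

    ~-sym : ∀ w w' → w ~ w' → w' ~ w
    ~-sym w w' (s≢s' , h) = s≢s' ∘ sym , disagree-sym w w' h

    ~-irrefl : ∀ w → ¬ w ~ w
    ~-irrefl w (s≢s , _) = s≢s refl

    ~⇔Cross : ∀ c d a b → (0F , c , a) ~ (1F , d , b) ⇔ Cross c d (toℕ a) (toℕ b)
    ~⇔Cross c d a b =
      mk⇔ (λ (_ , h) → #⇔Cross c d a b .to h) (λ h → (λ ()) , #⇔Cross c d a b .from h)

    open FourChainGraph _~?_ ~-sym ~-irrefl ~⇔Cross public

    -- Neighbourhoods grow with the position on A and shrink on B.
    ordered : Fin 2 → Fin M → Fin M
    ordered 0F = id
    ordered 1F = opposite

    ordered-involutive : ∀ s t → ordered s (ordered s t) ≡ t
    ordered-involutive 0F t = refl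
    ordered-involutive 1F t = Finₚ.opposite-involutive t

    ~-nested : ∀ s c i j → toℕ i ≤ toℕ j → ∀ w → (s , c , ordered s i) ~ w → (s , c , ordered s j) ~ w
    ~-nested 0F c i j i≤j (0F , d , b) (s≢s , _) = contradiction refl s≢s
    ~-nested 0F c i j i≤j (1F , d , b) h =
      ~⇔Cross c d j b .from (Cross-monoˡ c d i≤j (~⇔Cross c d i b .to h))
    ~-nested 1F d i j i≤j (0F , c , a) h = ~-sym _ _ (~⇔Cross c d a (opposite j) .from
      (Cross-antimonoʳ c d opposite-≤ (~⇔Cross c d a (opposite i) .to (~-sym _ _ h))))
      where
      opposite-≤ : toℕ (opposite j) ≤ toℕ (opposite i)
      opposite-≤ =
        subst₂ _≤_ (sym (Finₚ.opposite-prop j)) (sym (Finₚ.opposite-prop i)) (∸-monoʳ-≤ M (s≤s i≤j))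
    ~-nested 1F c i j i≤j (1F , d , b) (s≢s , _) = contradiction refl s≢s

    isChain : ∀ s c → IsChain G (λ v → side v ≡ isB s × chain v ≡ c)
    isChain s c = M , f , f-injective , f-in , f-onto , nested
      where
      f : Fin M → V G
      f i = encode (s , c , ordered s i)
      f-injective : Injective _≡_ _≡_ f
      f-injective {i} {j} eq =
        trans (sym (ordered-involutive s i)) (trans (cong (ordered s ∘ proj₂ ∘ proj₂)
        (encode-injective code {s , c , ordered s i} {s , c , ordered s j} eq)) (ordered-involutive s j))
      f-in : ∀ i → side (f i) ≡ isB s × chain (f i) ≡ c
      f-in i = cong (isB ∘ proj₁) (strictlyInverseˡ (s , c , ordered s i)) ,
               cong (proj₁ ∘ proj₂) (strictlyInverseˡ (s , c , ordered s i))
      f-onto : ∀ v → side v ≡ isB s × chain v ≡ c → ∃ λ i → f i ≡ v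
      f-onto v (hs , refl) with refl ← isB-injective (proj₁ (decode v)) s hs =
        ordered s t , trans (cong (λ t → encode (s , c , t)) (ordered-involutive s t)) (strictlyInverseʳ v)
        where t = proj₂ (proj₂ (decode v))
      nested : ∀ i j → toℕ i ≤ toℕ j → ∀ v → Edge G (f i) v → Edge G (f j) v
      nested i j i≤j v e = edge-decode code _~?_ ~-sym ~-irrefl (f j) v .from
        (subst (_~ decode v) (sym (strictlyInverseˡ (s , c , ordered s j))) (~-nested s c i j i≤j (decode v)
          (subst (_~ decode v) (strictlyInverseˡ (s , c , ordered s i))
            (edge-decode code _~?_ ~-sym ~-irrefl (f i) v .to e))))

    bichain : Bichain G
    bichain = side ,
      (λ u v e eq → proj₁ (edge-decode code _~?_ ~-sym ~-irrefl u v .to e) (isB-injective _ _ eq)) ,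
      (chain , isChain 0F) , (chain , isChain 1F)

splitPermutation-interpretsGrids : InterpretsGrids SplitPermutation
splitPermutation-interpretsGrids = interpretsGrids (near (extra 0F) (extra 1F) (extra 2F)) λ m →
  let open FourChains (suc m); open SplitPermutationGrid in
  G , splitPermutation , emb , emb-injective , chains , near-defined

bichain-interpretsGrids : InterpretsGrids Bichain
bichain-interpretsGrids = interpretsGrids (near (extra 0F) (extra 1F) (extra 2F)) λ m →
  let open FourChains (suc m); open BichainGrid in
  G , bichain , emb , emb-injective , chains , near-defined

-- Unit interval graphs.

p≤∣p∣ : ∀ p → p ℚ.≤ ℚ.∣ p ∣
p≤∣p∣ p with ℚₚ.≤-total 0ℚ p
... | inj₁ 0≤p = ℚₚ.≤-reflexive (sym (ℚₚ.0≤p⇒∣p∣≡p 0≤p))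
... | inj₂ p≤0 = ℚₚ.≤-trans p≤0 (ℚₚ.0≤∣p∣ p)

p-q≤r⇔p≤r+q : ∀ p q r → p ℚ.- q ℚ.≤ r ⇔ p ℚ.≤ r ℚ.+ q
p-q≤r⇔p≤r+q p q r = mk⇔
  (λ h → subst (ℚ._≤ r ℚ.+ q) (//-rightDividesˡ ℚₚ.+-0-group q p) (ℚₚ.+-monoˡ-≤ q h))
  (λ h → subst (p ℚ.- q ℚ.≤_) (//-rightDividesʳ ℚₚ.+-0-group q r) (ℚₚ.+-monoˡ-≤ (ℚ.- q) h))

∣p-q∣≤r⇔ : ∀ p q r → ℚ.∣ p ℚ.- q ∣ ℚ.≤ r ⇔ (q ℚ.≤ r ℚ.+ p × p ℚ.≤ r ℚ.+ q)
∣p-q∣≤r⇔ p q r = ⇔-trans (mk⇔ forward backward) (p-q≤r⇔p≤r+q q p r ×-⇔ p-q≤r⇔p≤r+q p q r)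
  where
  ∣q-p∣≡∣p-q∣ : ℚ.∣ q ℚ.- p ∣ ≡ ℚ.∣ p ℚ.- q ∣
  ∣q-p∣≡∣p-q∣ = trans (sym (ℚₚ.∣-p∣≡∣p∣ (q ℚ.- p))) (cong ℚ.∣_∣ (⁻¹-anti-homo-// ℚₚ.+-0-group q p))
  forward : ℚ.∣ p ℚ.- q ∣ ℚ.≤ r → q ℚ.- p ℚ.≤ r × p ℚ.- q ℚ.≤ r
  forward h = ℚₚ.≤-trans (p≤∣p∣ _) (subst (ℚ._≤ r) (sym ∣q-p∣≡∣p-q∣) h) , ℚₚ.≤-trans (p≤∣p∣ _) h
  backward : q ℚ.- p ℚ.≤ r × p ℚ.- q ℚ.≤ r → ℚ.∣ p ℚ.- q ∣ ℚ.≤ r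
  backward (h , h') with ℚₚ.∣p∣≡p∨∣p∣≡-p (p ℚ.- q)
  ... | inj₁ eq = subst (ℚ._≤ r) (sym eq) h'
  ... | inj₂ eq = subst (ℚ._≤ r) (sym (trans eq (⁻¹-anti-homo-// ℚₚ.+-0-group p q))) h

module _ (m : ℕ) where

  -- The fraction `t / (m + 1)`, as `mkℚᵘ` takes the denominator minus one. Dividing positions by
  -- the size `n = m + 1` turns intervals of length `n` into unit intervals.
  scaledᵘ : ℕ → ℚᵘ
  scaledᵘ t = mkℚᵘ (ℤ.+ t) m

  scaled : ℕ → ℚ
  scaled t = ℚ.fromℚᵘ (scaledᵘ t)

  toℚᵘ-scaled : ∀ t → ℚ.toℚᵘ (scaled t) ℚᵘ.≃ scaledᵘ t
  toℚᵘ-scaled t = ℚₚ.toℚᵘ-fromℚᵘ (scaledᵘ t)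

  -- On unnormalised rationals the common denominator `m + 1` is visible and cancels from the
  -- cross-multiplied inequality.
  scaled-≤ : ∀ s t → scaled s ℚ.≤ scaled t ⇔ s ≤ t
  scaled-≤ s t = mk⇔
    (λ h → ℤₚ.drop‿+≤+ (ℤₚ.*-cancelʳ-≤-pos (ℤ.+ s) (ℤ.+ t) (ℤ.+ suc m) (ℚᵘₚ.drop-*≤*
      (ℚᵘₚ.≤-respʳ-≃ (toℚᵘ-scaled t) (ℚᵘₚ.≤-respˡ-≃ (toℚᵘ-scaled s) (ℚₚ.toℚᵘ-mono-≤ h))))))
    (λ h → ℚₚ.toℚᵘ-cancel-≤ (ℚᵘₚ.≤-respʳ-≃ (ℚᵘₚ.≃-sym (toℚᵘ-scaled t))
      (ℚᵘₚ.≤-respˡ-≃ (ℚᵘₚ.≃-sym (toℚᵘ-scaled s))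
        (ℚᵘ.*≤* (ℤₚ.*-monoʳ-≤-nonNeg (ℤ.+ suc m) (ℤ.+≤+ h))))))

  1+scaled : ∀ t → 1ℚ ℚ.+ scaled t ≡ scaled (t + suc m)
  1+scaled t = ℚₚ.toℚᵘ-injective (ℚᵘₚ.≃-trans (ℚₚ.toℚᵘ-homo-+ 1ℚ (scaled t))
    (ℚᵘₚ.≃-trans (ℚᵘₚ.+-congʳ (ℚ.toℚᵘ 1ℚ) (toℚᵘ-scaled t))
      (ℚᵘₚ.≃-trans (ℚᵘ.*≡* sum) (ℚᵘₚ.≃-sym (toℚᵘ-scaled (t + suc m))))))
    where
    -- The cross-multiplied form of `1 / 1 + t / (m + 1) = (t + (m + 1)) / (m + 1)`.
    sum : (ℤ.1ℤ ℤ.* ℤ.+ suc m ℤ.+ ℤ.+ t ℤ.* ℤ.1ℤ) ℤ.* ℤ.+ suc m ≡ ℤ.+ (t + suc m) ℤ.* (ℤ.1ℤ ℤ.* ℤ.+ suc m)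
    sum = cong₂ ℤ._*_
      (trans (cong₂ ℤ._+_ (ℤₚ.*-identityˡ (ℤ.+ suc m)) (ℤₚ.*-identityʳ (ℤ.+ t))) (ℤₚ.+-comm (ℤ.+ suc m) (ℤ.+ t)))
      (sym (ℤₚ.*-identityˡ (ℤ.+ suc m)))

  scaled-near : ∀ s t → ℚ.∣ scaled s ℚ.- scaled t ∣ ℚ.≤ 1ℚ ⇔ (t ≤ s + suc m × s ≤ t + suc m)
  scaled-near s t = ⇔-trans (∣p-q∣≤r⇔ (scaled s) (scaled t) 1ℚ) (shift t s ×-⇔ shift s t)
    where
    shift : ∀ s t → scaled s ℚ.≤ 1ℚ ℚ.+ scaled t ⇔ s ≤ t + suc m
    shift s t rewrite 1+scaled t = scaled-≤ s (t + suc m)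

module UnitIntervalGrid (m : ℕ) where

  x : Cell (suc m) → ℚ
  x u = scaled m (pos u)

  Overlap : Cell (suc m) → Cell (suc m) → Set
  Overlap u v = u ≢ v × ℚ.∣ x u ℚ.- x v ∣ ℚ.≤ 1ℚ

  overlap? : ∀ u v → Dec (Overlap u v)
  overlap? u v = ¬? (≡-dec Finₚ._≟_ Finₚ._≟_ u v) ×-dec (ℚ.∣ x u ℚ.- x v ∣ ℚₚ.≤? 1ℚ)

  overlap-sym : ∀ u v → Overlap u v → Overlap v u
  overlap-sym u v (u≢v , h) = u≢v ∘ sym ,
    scaled-near m (pos v) (pos u) .from (swap (scaled-near m (pos u) (pos v) .to h))

  overlap-irrefl : ∀ v → ¬ Overlap v v
  overlap-irrefl v (v≢v , _) = v≢v refl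

  code : Fin (suc (suc m) * suc m) ↔ Cell (suc m)
  code = Finₚ.*↔×

  G : Graph
  G = graph code overlap? overlap-sym overlap-irrefl

  unitInterval : UnitInterval G
  unitInterval = x ∘ Inverse.to code , λ u v u≢v →
    ⇔-trans (edge-decode code overlap? overlap-sym overlap-irrefl u v) (mk⇔ proj₂ (u≢v ∘ decode-injective code ,_))

  near-edge : ∀ u v → NextClass u v → Edge G (Inverse.from code u) (Inverse.from code v) ⇔ Near u v
  near-edge u v label = ⇔-trans (edge-encode code overlap? overlap-sym overlap-irrefl u v) (mk⇔
    (λ (_ , h) → scaled-near m (pos u) (pos v) .to h)
    -- A cell is not in the class following its own, so the two cells are distinct.
    (λ h → (λ { refl → rotate-≢ (mod3 (col u)) label }) , scaled-near m (pos u) (pos v) .from h))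

unitInterval-interpretsGrids : InterpretsGrids UnitInterval
unitInterval-interpretsGrids = interpretsGrids {0} edge λ m →
  let open UnitIntervalGrid m in
  G , unitInterval , Inverse.from code , encode-injective code , (λ ()) ,
  λ ρ x y u v xu yv label → subst₂ (λ a b → Edge G a b ⇔ Near u v) (sym xu) (sym yv) (near-edge u v label)

theorem5 : InterpretsGrids Bichain
    × InterpretsGrids SplitPermutation
    × InterpretsGrids BipartitePermutation
    × InterpretsGrids UnitInterval
theorem5 =
  bichain-interpretsGrids ,
  splitPermutation-interpretsGrids ,
  bipartitePermutation-interpretsGrids ,
  unitInterval-interpretsGrids
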